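{- Let $m_1,\dots,m_n$ be soft modules with areas $s_1\ge s_2\ge\dots\ge s_n>0$, and let the circuit be a rectangle of width $W>0$ and height $H>0$ with $WH=\sum_{k=1}^n s_k$. Suppose that: (1) all the modules have a uniform bounding factor $\lambda\ge 3$, i.e. the allowed aspect ratio (height/width) interval of every module is $[1/\lambda,\lambda]$; (2) the aspect ratio $\gamma_A=H/W$ of the circuit lies in $[1/\lambda,\lambda]$; (3) $$\max_{1\le i\le n-1}\ \frac{s_i}{\sum_{j=i+1}^n s_j}\le\lambda-1 .$$ Then the Iterative Merging Placement (IMP) algorithm places all the modules feasibly, i.e. the dimensions and positions it assigns to $m_1,\dots,m_n$ form a feasible layout on the circuit.
   Context: **Problem.** A soft module $m_i$ has a fixed area $s_i$ and an allowed aspect ratio interval $[1/\lambda_i,\lambda_i]$, $\lambda_i\ge1$; $\lambda_i$ is its bounding factor. The aspect ratio of a rectangle is height divided by width. A layout assigns to each $m_i$ an axis-parallel rectangle of width $w_i$ and height $h_i$ with $w_ih_i=s_i$, with bottom-left vertex $(x_{i1},y_{i1})$ and upper-right vertex $(x_{i2},y_{i2})$. It is feasible on the circuit $[0,W]\times[0,H]$ if for all $i\neq j$: - $x_{i2}-x_{i1}=w_i$ and $y_{i2}-y_{i1}=h_i$; - $1/\lambda_i\le h_i/w_i\le\lambda_i$; - $\max(x_{i1}-x_{j2},\,y_{i1}-y_{j2},\,x_{j1}-x_{i2},\,y_{j1}-y_{i2})\ge0$ (no overlap); - $0\le x_{ik}\le W$ and $0\le y_{ik}\le H$ for $k\in\{1,2\}$.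 **Composite modules.** A single soft module is a composite module. Two composite modules (the sub-modules) may be merged, horizontally (side by side) or vertically (one on top of the other), along sides of equal length to form a bigger composite module, whose area is the sum of their areas. **The IMP algorithm.** Input: the sequence $m_1,\dots,m_n$, sorted by non-increasing area, and the $W\times H$ circuit with $WH=\sum_k s_k$. *Stage I.* While the current sequence contains more than one module: remove the two last modules $m_i,m_j$ of the sequence (two modules of least area) and merge them into a composite module $m_c$, recording only which two sub-modules it has (not yet the direction or order of merging); insert $m_c$ into the sequence at the position $k$ such that the areas satisfy $s_{k-1}>s_k\ge s_{k+1}$, where $s_k$ is the area of $m_c$ (so the sequence stays non-increasing, and $m_c$ is put in front of modules of equal area); push $m_c$ onto a stack. *Stage II.* Place the single remaining module so that it coincides with the circuit rectangle. While the stack is nonempty: pop a composite module $m_c$, with sub-modules $m_i,m_j$, whose rectangle has already been determined and has aspect ratio $\gamma_c$. If $\gamma_c\ge1$, $m_i$ and $m_j$ are merged vertically with the larger one on top; otherwise they are merged horizontally with the larger one on the left. That is, the rectangle of $m_c$ is cut by one horizontal (respectively vertical) segment into two rectangles having the areas of $m_i$ and $m_j$, which become the rectangles of $m_i$ and $m_j$. The output is the collection of rectangles assigned to the original modules $m_1,\dots,m_n$. -}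

module Defs where

open import Level using (Level; _⊔_)
open import Algebra.Bundles using (CommutativeRing)
open import Algebra.Structures using (IsCommutativeRing)
open import Data.Bool.Base using (Bool; if_then_else_)
open import Data.Fin.Base as Fin using (Fin; zero; suc; opposite)
open import Data.Fin.Properties as Fin using ()
open import Data.List.Base using (List; []; _∷_)
open import Data.Maybe.Base using (Maybe; just; nothing)
open import Data.Nat.Base as ℕ using (ℕ; zero; suc)
open import Data.Product.Base using (∃; _×_; _,_)
open import Data.Vec.Base using (Vec; []; _∷_; tabulate)
open import Data.Vec.Functional using (Vector; tail)
open import Relation.Binary.Bundles using (DecTotalOrder)
open import Relation.Binary.Core using (Rel)
open import Relation.Binary.Definitions using (DecidableEquality)
open import Relation.Binary.PropositionalEquality.Core using (_≡_; refl; _≢_)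
open import Relation.Binary.Structures using (IsDecTotalOrder)
open import Relation.Nullary.Decidable.Core using (yes; no; does)
open import Relation.Nullary.Negation.Core using (¬_)
import Algebra.Construct.NaturalChoice.Max as Max
import Algebra.Definitions.RawMonoid as RawMonoid
import Relation.Binary.Properties.DecTotalOrder as DecTotalOrderProperties

-- Inversion is a total function, but nothing is assumed about 0# ⁻¹
-- beyond congruence.
record OrderedField (c ℓ₁ ℓ₂ : Level) : Set (Level.suc (c ⊔ ℓ₁ ⊔ ℓ₂)) where
  infix  8 -_ _⁻¹
  infixl 7 _*_ _/_
  infixl 6 _+_ _-_
  infix  4 _≈_ _≤_
  field
    Carrier           : Set c
    _≈_               : Rel Carrier ℓ₁
    _≤_               : Rel Carrier ℓ₂
    _+_ _*_           : Carrier → Carrier → Carrier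
    -_ _⁻¹            : Carrier → Carrier
    0# 1#             : Carrier
    isCommutativeRing : IsCommutativeRing _≈_ _+_ _*_ -_ 0# 1#
    isDecTotalOrder   : IsDecTotalOrder _≈_ _≤_
    0≉1               : ¬ 0# ≈ 1#
    ⁻¹-cong           : ∀ {x y} → x ≈ y → x ⁻¹ ≈ y ⁻¹
    ⁻¹-inverseʳ       : ∀ {x} → ¬ x ≈ 0# → x * x ⁻¹ ≈ 1#
    +-monoˡ-≤         : ∀ {x y} z → x ≤ y → x + z ≤ y + z
    *-nonneg          : ∀ {x y} → 0# ≤ x → 0# ≤ y → 0# ≤ x * y

  commutativeRing : CommutativeRing c ℓ₁
  commutativeRing = record { isCommutativeRing = isCommutativeRing }

  decTotalOrder : DecTotalOrder c ℓ₁ ℓ₂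
  decTotalOrder = record { isDecTotalOrder = isDecTotalOrder }

  open DecTotalOrder decTotalOrder public using (totalOrder; _≤?_)
  open DecTotalOrderProperties decTotalOrder public using (_<_)
  open Max totalOrder public using () renaming (_⊔_ to max)
  open RawMonoid (CommutativeRing.+-rawMonoid commutativeRing) public
    using (sum)

  _-_ _/_ : Carrier → Carrier → Carrier
  x - y = x + - y
  x / y = x * y ⁻¹

  3# : Carrier
  3# = 1# + 1# + 1#

-- Distinct composites occurring in a run of the algorithm contain different
-- original modules, so the merge tree identifies the composite.
data Composite (n : ℕ) : Set where
  single : Fin n → Composite n
  merge  : (mᵢ mⱼ : Composite n) → Composite n

_≟_ : ∀ {n} → DecidableEquality (Composite n)
single i  ≟ single j    with i Fin.≟ j
... | yes refl = yes refl
... | no  i≢j  = no λ { refl → i≢j refl }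
single _  ≟ merge _ _   = no λ ()
merge _ _ ≟ single _    = no λ ()
merge a b ≟ merge a′ b′ with a ≟ a′ | b ≟ b′
... | yes refl | yes refl = yes refl
... | no  a≢a′ | _        = no λ { refl → a≢a′ refl }
... | yes _    | no b≢b′  = no λ { refl → b≢b′ refl }

module Placement {c ℓ₁ ℓ₂} (F : OrderedField c ℓ₁ ℓ₂) where
  open OrderedField F

  -- A placed module: its dimensions w, h, its bottom-left vertex (x₁ , y₁)
  -- and its upper-right vertex (x₂ , y₂).
  record Rect : Set c where
    constructor rect
    field
      w h x₁ y₁ x₂ y₂ : Carrier

    aspect : Carrier
    aspect = h / w

  open Rect

  record Feasible {n : ℕ} (s bound : Vector Carrier n) (W H : Carrier)
                  (L : Fin n → Rect) : Set (c ⊔ ℓ₁ ⊔ ℓ₂) where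
    field
      w>0        : ∀ i → 0# < w (L i)
      h>0        : ∀ i → 0# < h (L i)
      wh≈s       : ∀ i → w (L i) * h (L i) ≈ s i
      x₂-x₁≈w    : ∀ i → x₂ (L i) - x₁ (L i) ≈ w (L i)
      y₂-y₁≈h    : ∀ i → y₂ (L i) - y₁ (L i) ≈ h (L i)
      aspect-min : ∀ i → 1# / bound i ≤ aspect (L i)
      aspect-max : ∀ i → aspect (L i) ≤ bound i
      no-overlap : ∀ {i j} → i ≢ j →
        0# ≤ max (max (x₁ (L i) - x₂ (L j)) (y₁ (L i) - y₂ (L j)))
                 (max (x₁ (L j) - x₂ (L i)) (y₁ (L j) - y₂ (L i)))
      0≤x₁       : ∀ i → 0# ≤ x₁ (L i)
      x₁≤W       : ∀ i → x₁ (L i) ≤ W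
      0≤x₂       : ∀ i → 0# ≤ x₂ (L i)
      x₂≤W       : ∀ i → x₂ (L i) ≤ W
      0≤y₁       : ∀ i → 0# ≤ y₁ (L i)
      y₁≤H       : ∀ i → y₁ (L i) ≤ H
      0≤y₂       : ∀ i → 0# ≤ y₂ (L i)
      y₂≤H       : ∀ i → y₂ (L i) ≤ H

  -- The sum of all entries strictly after position i.
  sumAfter : ∀ {n} → Vector Carrier n → Fin n → Carrier
  sumAfter s zero    = sum (tail s)
  sumAfter s (suc i) = sumAfter (tail s) i

  area : ∀ {n} → Vector Carrier n → Composite n → Carrier
  area s (single i)  = s i
  area s (merge a b) = area s a + area s b

  -- An entry (mᵢ , mⱼ) stands for the composite merge mᵢ mⱼ; the head is the
  -- top of the stack.
  Stack : ℕ → Set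
  Stack n = List (Composite n × Composite n)

  -- "nothing" marks a module whose rectangle has not been determined.
  Partial : ℕ → Set c
  Partial n = Composite n → Maybe Rect

  _[_≔_] : ∀ {n} → Partial n → Composite n → Rect → Partial n
  (ρ [ m ≔ r ]) m′ = if does (m ≟ m′) then just r else ρ m′

  -- Which sub-module counts as the larger one when their areas are equal is
  -- left open: tie a b ≡ true selects a.
  module IMP {n : ℕ} (s : Vector Carrier n) (W H : Carrier)
             (tie : Composite n → Composite n → Bool) where

    -- Sequences of modules are stored back to front: the head is the last
    -- module, and areas are non-decreasing from the head on.
    insert : ∀ {k} → Composite n → Vec (Composite n) k → Vec (Composite n) (suc k)
    insert m []       = m ∷ []
    insert m (x ∷ xs) =
      if does (area s x ≤? area s m) then x ∷ insert m xs else m ∷ x ∷ xs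

    stageI : ∀ {k} → Vec (Composite n) (suc k) → Stack n → Composite n × Stack n
    stageI (m ∷ [])       st = m , st
    stageI (mⱼ ∷ mᵢ ∷ ms) st =
      stageI (insert (merge mᵢ mⱼ) ms) ((mᵢ , mⱼ) ∷ st)

    largerFirst : Composite n → Composite n → Composite n × Composite n
    largerFirst a b =
      if does (area s b ≤? area s a)
      then (if does (area s a ≤? area s b)
            then (if tie a b then a , b else b , a)
            else (a , b))
      else (b , a)

    -- The rectangles of the larger and of the smaller sub-module, whose areas
    -- are p and q, inside the rectangle r of the composite.
    cut : Rect → (p q : Carrier) → Rect × Rect
    cut r p q =
      if does (1# ≤? aspect r)
      then (let y = y₁ r + q / w r in
              rect (w r) (p / w r) (x₁ r) y      (x₂ r) (y₂ r)
            , rect (w r) (q / w r) (x₁ r) (y₁ r) (x₂ r) y)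
      else (let x = x₁ r + p / h r in
              rect (p / h r) (h r) (x₁ r) (y₁ r) x      (y₂ r)
            , rect (q / h r) (h r) x      (y₁ r) (x₂ r) (y₂ r))

    split : Composite n → Composite n → Rect → Partial n → Partial n
    split mᵢ mⱼ r ρ =
      let a , b   = largerFirst mᵢ mⱼ
          rᵃ , rᵇ = cut r (area s a) (area s b)
      in (ρ [ a ≔ rᵃ ]) [ b ≔ rᵇ ]

    stageII : Stack n → Partial n → Partial n
    stageII []               ρ = ρ
    stageII ((mᵢ , mⱼ) ∷ st) ρ with ρ (merge mᵢ mⱼ)
    ... | just r  = stageII st (split mᵢ mⱼ r ρ)
    ... | nothing = stageII st ρ

    circuit : Rect
    circuit = rect W H 0# 0# W H

    place : Composite n × Stack n → Partial n
    place (root , st) = stageII st ((λ _ → nothing) [ root ≔ circuit ])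

  module _ {n : ℕ} (s : Vector Carrier (suc n)) (W H : Carrier)
           (tie : Composite (suc n) → Composite (suc n) → Bool) where
    open IMP s W H tie

    imp : Fin (suc n) → Maybe Rect
    imp i = place (stageI (tabulate (λ j → single (opposite j))) []) (single i)

    IMPPlacesFeasibly : (bound : Vector Carrier (suc n)) → Set (c ⊔ ℓ₁ ⊔ ℓ₂)
    IMPPlacesFeasibly bound =
      ∃ λ (L : Fin (suc n) → Rect) →
        (∀ i → imp i ≡ just (L i)) × Feasible s bound W H L

{-# OPTIONS --safe #-}
module Submission where

-- Call two sub-modules balanced if each has at least the fraction 1 / Λ of
-- their total area.  Cutting a rectangle of aspect ratio in [1 / Λ , Λ] across
-- its longer side into balanced parts keeps both aspect ratios in that range,
-- so it suffices that stage I only merges balanced modules.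
--
-- Let mⱼ be the smallest and mᵢ the second smallest module at some step.  Every
-- composite in the sequence has area at most twice that of any module in it: its
-- two parts were minimal when merged, and later merging only makes modules
-- larger.  If mᵢ or any module before it is composite, mᵢ thus has area at
-- most 2 mⱼ ≤ (Λ - 1) mⱼ.  Otherwise mᵢ and all modules before it are original,
-- so mⱼ comprises all original modules after mᵢ, and the hypothesis on the ratios
-- is exactly mᵢ ≤ (Λ - 1) mⱼ.

open import Defs
open import Algebra.Bundles using (CommutativeRing)
open import Data.Bool.Base using (Bool; true; false)
open import Data.Empty using (⊥-elim)
open import Data.Fin.Base as Fin using (Fin; zero; suc; toℕ; inject₁; opposite; fromℕ)
import Data.Fin.Properties as Fin
open import Data.Fin.Relation.Unary.Top using (view; ‵fromℕ; ‵inject₁)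
open import Data.List.Base as List using (List; []; _∷_)
open import Data.List.Membership.Propositional using (_∈_)
open import Data.List.Membership.Propositional.Properties using (∈-AllPairs₂; ∈-tabulate⁺)
open import Data.List.Relation.Binary.Permutation.Propositional
  using (_↭_; prep; swap; trans; ↭-refl; ↭-sym; ↭⇒↭ₛ; ↭⇒↭ₛ′)
open import Data.List.Relation.Binary.Permutation.Propositional.Properties using (All-resp-↭; map⁺)
import Data.List.Relation.Binary.Permutation.Setoid.Properties as Permutation
open import Data.List.Relation.Unary.All as All using (All; []; _∷_)
open import Data.List.Relation.Unary.AllPairs as AllPairs using (AllPairs; []; _∷_)
import Data.List.Relation.Unary.AllPairs.Properties as AllPairs
open import Data.List.Relation.Unary.Any using (Any; here; there)
open import Data.Maybe.Base using (just; nothing)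
open import Data.Maybe.Properties using (just-injective)
open import Data.Nat.Base as ℕ using (ℕ; zero; suc)
import Data.Nat.Properties as ℕ
open import Data.Product.Base using (∃; _×_; _,_; proj₁; proj₂)
open import Data.Sum.Base as Sum using (_⊎_; inj₁; inj₂; [_,_]′)
open import Data.Vec.Base using (Vec; []; _∷_; tabulate; toList)
open import Data.Vec.Functional using (Vector; tail)
open import Function.Base using (_∘_; _on_)
open import Level using (_⊔_)
open import Relation.Binary.Bundles using (DecTotalOrder)
open import Relation.Binary.Core using (Rel)
open import Relation.Binary.Definitions using (Symmetric)
open import Relation.Binary.PropositionalEquality as ≡ using (_≡_; _≢_; ≢-sym)
open import Relation.Nullary.Decidable using (yes; no; dec-true; dec-false)
open import Relation.Nullary.Negation using (¬_; contradiction)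
import Algebra.Construct.NaturalChoice.Max as Max
import Algebra.Properties.Ring as RingProperties
import Algebra.Solver.Ring.NaturalCoefficients.Default as SemiringSolver
import Relation.Binary.Properties.DecTotalOrder as DecTotalOrderProperties
import Relation.Binary.Reasoning.PartialOrder as ≤-Reasoning

-- Auxiliary facts on lists and vectors.

AllPairs-resp-↭ : ∀ {a r} {A : Set a} {R : Rel A r} {xs ys} → Symmetric R →
                  xs ↭ ys → AllPairs R xs → AllPairs R ys
AllPairs-resp-↭ {A = A} {R} R-sym xs↭ys =
  Permutation.AllPairs-resp-↭ (≡.setoid A) R-sym (≡.resp₂ R) (↭⇒↭ₛ xs↭ys)

toList-tabulate : ∀ {a} {A : Set a} {n} (f : Fin n → A) →
                  toList (tabulate f) ≡ List.tabulate f
toList-tabulate {n = zero}  f = ≡.refl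
toList-tabulate {n = suc n} f = ≡.cong (f zero ∷_) (toList-tabulate (f ∘ suc))

-- Arithmetic and inequalities in an ordered field.

module OrderedFieldProperties {c ℓ₁ ℓ₂} (F : OrderedField c ℓ₁ ℓ₂) where
  open OrderedField F
  open CommutativeRing commutativeRing public
    using (ring; commutativeSemiring; setoid; sym; reflexive; isEquivalence;
           +-cong; +-congˡ; +-congʳ; +-assoc; +-comm; +-identityˡ; +-identityʳ;
           *-congˡ; *-congʳ; *-assoc; *-comm; *-identityˡ; *-identityʳ;
           distribʳ; zeroˡ; zeroʳ; -‿inverseˡ; -‿inverseʳ;
           +-isCommutativeMonoid)
    renaming (refl to ≈-refl; trans to ≈-trans)
  open DecTotalOrder decTotalOrder public
    using (poset; total; antisym; ≤-respˡ-≈; ≤-respʳ-≈)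
    renaming (refl to ≤-refl; trans to ≤-trans)
  open DecTotalOrderProperties decTotalOrder public using (≰⇒≥; <-respʳ-≈)
  open RingProperties ring public using (-1*x≈-x; -‿involutive; +-cancelʳ)
  open SemiringSolver commutativeSemiring public using (solve; _:=_; _:+_; _:*_)
  open ≤-Reasoning poset

  +-monoʳ-≤ : ∀ {x y} z → x ≤ y → z + x ≤ z + y
  +-monoʳ-≤ {x} {y} z x≤y = begin
    z + x  ≈⟨ +-comm z x ⟩
    x + z  ≤⟨ +-monoˡ-≤ z x≤y ⟩
    y + z  ≈⟨ +-comm y z ⟩
    z + y  ∎

  +-mono-≤ : ∀ {x y u v} → x ≤ y → u ≤ v → x + u ≤ y + v
  +-mono-≤ x≤y u≤v = ≤-trans (+-monoˡ-≤ _ x≤y) (+-monoʳ-≤ _ u≤v)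

  x≤x+y : ∀ {x y} → 0# ≤ y → x ≤ x + y
  x≤x+y {x} 0≤y = ≤-respˡ-≈ (+-identityʳ x) (+-monoʳ-≤ x 0≤y)

  x≤y+x : ∀ {x y} → 0# ≤ y → x ≤ y + x
  x≤y+x {x} 0≤y = ≤-respˡ-≈ (+-identityˡ x) (+-monoˡ-≤ x 0≤y)

  x-y+y≈x : ∀ x y → x - y + y ≈ x
  x-y+y≈x x y = ≈-trans (+-assoc x (- y) y)
    (≈-trans (+-congˡ (-‿inverseˡ y)) (+-identityʳ x))

  x≤y⇒0≤y-x : ∀ {x y} → x ≤ y → 0# ≤ y - x
  x≤y⇒0≤y-x {x} x≤y = ≤-respˡ-≈ (-‿inverseʳ x) (+-monoˡ-≤ (- x) x≤y)

  x+y≈z⇒z-x≈y : ∀ {x y z} → x + y ≈ z → z - x ≈ y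
  x+y≈z⇒z-x≈y {x} {y} {z} x+y≈z =
    +-cancelʳ x (z - x) y (≈-trans (x-y+y≈x z x) (≈-trans (sym x+y≈z) (+-comm x y)))

  -- The axioms give only nonnegativity of products, so `y * z` is split as `(y - x) * z + x * z`.
  *-monoˡ-≤ : ∀ {x y z} → 0# ≤ z → x ≤ y → x * z ≤ y * z
  *-monoˡ-≤ {x} {y} {z} 0≤z x≤y = begin
    x * z                ≤⟨ x≤y+x (*-nonneg (x≤y⇒0≤y-x x≤y) 0≤z) ⟩
    (y - x) * z + x * z  ≈⟨ distribʳ z (y - x) x ⟨
    (y - x + x) * z      ≈⟨ *-congʳ (x-y+y≈x y x) ⟩
    y * z                ∎

  *-monoʳ-≤ : ∀ {x y z} → 0# ≤ z → x ≤ y → z * x ≤ z * y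
  *-monoʳ-≤ {x} {y} {z} 0≤z x≤y = begin
    z * x  ≈⟨ *-comm z x ⟩
    x * z  ≤⟨ *-monoˡ-≤ 0≤z x≤y ⟩
    y * z  ≈⟨ *-comm y z ⟩
    z * y  ∎

  -- If 1 were at most 0, then -1 would be nonnegative, and so would its square, which is 1.
  0≤1 : 0# ≤ 1#
  0≤1 with total 0# 1#
  ... | inj₁ 0≤1 = 0≤1
  ... | inj₂ 1≤0 = begin
    0#             ≤⟨ *-nonneg 0≤-1 0≤-1 ⟩
    - 1# * - 1#    ≈⟨ -1*x≈-x (- 1#) ⟩
    - (- 1#)       ≈⟨ -‿involutive 1# ⟩
    1#             ∎
    where
    0≤-1 : 0# ≤ - 1#
    0≤-1 = ≤-respʳ-≈ (+-identityˡ (- 1#)) (x≤y⇒0≤y-x 1≤0)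

  0<⇒≉0 : ∀ {x} → 0# < x → ¬ x ≈ 0#
  0<⇒≉0 (_ , 0≉x) x≈0 = 0≉x (sym x≈0)

  <-≤-trans : ∀ {x y} → 0# < x → x ≤ y → 0# < y
  <-≤-trans (0≤x , 0≉x) x≤y =
    ≤-trans 0≤x x≤y , λ 0≈y → 0≉x (antisym 0≤x (≤-respʳ-≈ (sym 0≈y) x≤y))

  +-pos : ∀ {x y} → 0# < x → 0# < y → 0# < x + y
  +-pos 0<x (0≤y , _) = <-≤-trans 0<x (x≤x+y 0≤y)

  x*y*y⁻¹≈x : ∀ {x y} → 0# < y → x * y * y ⁻¹ ≈ x
  x*y*y⁻¹≈x {x} {y} 0<y = ≈-trans (*-assoc x y (y ⁻¹))
    (≈-trans (*-congˡ (⁻¹-inverseʳ (0<⇒≉0 0<y))) (*-identityʳ x))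

  x/y*y≈x : ∀ {x y} → 0# < y → x / y * y ≈ x
  x/y*y≈x {x} {y} 0<y = ≈-trans
    (solve 3 (λ x y z → x :* z :* y := x :* y :* z) ≈-refl x y (y ⁻¹))
    (x*y*y⁻¹≈x 0<y)

  ⁻¹-pos : ∀ {x} → 0# < x → 0# < x ⁻¹
  ⁻¹-pos {x} 0<x@(0≤x , _) = 0≤x⁻¹ , λ 0≈x⁻¹ →
    0≉1 (≈-trans (sym (zeroʳ x)) (≈-trans (*-congˡ 0≈x⁻¹) x*x⁻¹≈1))
    where
    x*x⁻¹≈1 : x * x ⁻¹ ≈ 1#
    x*x⁻¹≈1 = ⁻¹-inverseʳ (0<⇒≉0 0<x)
    0≤x⁻¹ : 0# ≤ x ⁻¹
    0≤x⁻¹ with total 0# (x ⁻¹)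
    ... | inj₁ 0≤x⁻¹ = 0≤x⁻¹
    ... | inj₂ x⁻¹≤0 = ⊥-elim (0≉1 (antisym 0≤1
      (≤-respˡ-≈ x*x⁻¹≈1 (≤-respʳ-≈ (zeroʳ x) (*-monoʳ-≤ 0≤x x⁻¹≤0)))))

  *-cancelʳ-≤ : ∀ {x y z} → 0# < z → x * z ≤ y * z → x ≤ y
  *-cancelʳ-≤ {x} {y} {z} 0<z xz≤yz = begin
    x             ≈⟨ x*y*y⁻¹≈x 0<z ⟨
    x * z * z ⁻¹  ≤⟨ *-monoˡ-≤ (proj₁ (⁻¹-pos 0<z)) xz≤yz ⟩
    y * z * z ⁻¹  ≈⟨ x*y*y⁻¹≈x 0<z ⟩
    y             ∎

  x/y≤z⇒x≤z*y : ∀ {x y z} → 0# < y → x / y ≤ z → x ≤ z * y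
  x/y≤z⇒x≤z*y 0<y x/y≤z = ≤-respˡ-≈ (x/y*y≈x 0<y) (*-monoˡ-≤ (proj₁ 0<y) x/y≤z)

  x≤z*y⇒x/y≤z : ∀ {x y z} → 0# < y → x ≤ z * y → x / y ≤ z
  x≤z*y⇒x/y≤z 0<y x≤zy = *-cancelʳ-≤ 0<y (≤-respˡ-≈ (sym (x/y*y≈x 0<y)) x≤zy)

  z≤x/y⇒z*y≤x : ∀ {x y z} → 0# < y → z ≤ x / y → z * y ≤ x
  z≤x/y⇒z*y≤x 0<y z≤x/y = ≤-respʳ-≈ (x/y*y≈x 0<y) (*-monoˡ-≤ (proj₁ 0<y) z≤x/y)

  z*y≤x⇒z≤x/y : ∀ {x y z} → 0# < y → z * y ≤ x → z ≤ x / y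
  z*y≤x⇒z≤x/y 0<y zy≤x = *-cancelʳ-≤ 0<y (≤-respʳ-≈ (sym (x/y*y≈x 0<y)) zy≤x)

  1/x*y≈y/x : ∀ {x y} → 1# / x * y ≈ y / x
  1/x*y≈y/x {x} {y} = ≈-trans (*-congʳ (*-identityˡ (x ⁻¹))) (*-comm (x ⁻¹) y)

  -- This and its converse below pass between the lower aspect bound with `1# / Λ` and the product
  -- form used in `Shape`.
  w≤Λh⇒w/Λ≤h : ∀ {Λ w h} → 0# < Λ → w ≤ Λ * h → 1# / Λ * w ≤ h
  w≤Λh⇒w/Λ≤h 0<Λ w≤Λh =
    ≤-respˡ-≈ (sym 1/x*y≈y/x) (x≤z*y⇒x/y≤z 0<Λ (≤-respʳ-≈ (*-comm _ _) w≤Λh))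

  w/Λ≤h⇒w≤Λh : ∀ {Λ w h} → 0# < Λ → 1# / Λ * w ≤ h → w ≤ Λ * h
  w/Λ≤h⇒w≤Λh 0<Λ w/Λ≤h =
    ≤-respʳ-≈ (*-comm _ _) (x/y≤z⇒x≤z*y 0<Λ (≤-respˡ-≈ 1/x*y≈y/x w/Λ≤h))

  *-pos : ∀ {x y} → 0# < x → 0# < y → 0# < x * y
  *-pos {x} {y} (0≤x , 0≉x) 0<y@(0≤y , _) = *-nonneg 0≤x 0≤y , λ 0≈xy → 0≉x
    (≈-trans (sym (zeroˡ (y ⁻¹))) (≈-trans (*-congʳ 0≈xy) (x*y*y⁻¹≈x 0<y)))

  /-pos : ∀ {x y} → 0# < x → 0# < y → 0# < x / y
  /-pos 0<x 0<y = *-pos 0<x (⁻¹-pos 0<y)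

-- Rectangles: aspect bounds, containment, separation, and a single cut.

module Geometry {c ℓ₁ ℓ₂} (F : OrderedField c ℓ₁ ℓ₂) where
  open OrderedField F
  open OrderedFieldProperties F
  open Placement F
  open Rect
  open ≤-Reasoning poset
  open Max totalOrder using (x≤x⊔y; x≤y⊔x)

  -- The aspect bounds are kept as products, so exchanging `w` and `h` exchanges the two bounds, and
  -- cuts by a vertical segment follow from cuts by a horizontal one through `transpose`.
  record Shape (Λ A w h : Carrier) : Set (c ⊔ ℓ₁ ⊔ ℓ₂) where
    field
      w>0  : 0# < w
      h>0  : 0# < h
      wh≈A : w * h ≈ A
      w≤Λh : w ≤ Λ * h
      h≤Λw : h ≤ Λ * w

  open Shape

  transpose : ∀ {Λ A w h} → Shape Λ A w h → Shape Λ A h w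
  transpose sh = record
    { w>0  = h>0 sh
    ; h>0  = w>0 sh
    ; wh≈A = ≈-trans (*-comm _ _) (wh≈A sh)
    ; w≤Λh = h≤Λw sh
    ; h≤Λw = w≤Λh sh
    }

  -- A part of a tall rectangle cannot become too tall, and it becomes too wide
  -- only if it takes less than the fraction 1 / Λ of the area.
  slice : ∀ {Λ w h p q} → Shape Λ (p + q) w h → w ≤ h → 0# < p → 0# < q →
          p + q ≤ Λ * p → Shape Λ p w (p / w)
  slice {Λ} {w} {h} {p} {q} sh w≤h 0<p 0<q p+q≤Λp = record
    { w>0  = w>0 sh
    ; h>0  = /-pos 0<p (w>0 sh)
    ; wh≈A = ≈-trans (*-comm w (p / w)) (x/y*y≈x (w>0 sh))
    ; w≤Λh = *-cancelʳ-≤ (w>0 sh) (begin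
        w * w            ≤⟨ *-monoʳ-≤ (proj₁ (w>0 sh)) w≤h ⟩
        w * h            ≈⟨ wh≈A sh ⟩
        p + q            ≤⟨ p+q≤Λp ⟩
        Λ * p            ≈⟨ *-congˡ (x/y*y≈x (w>0 sh)) ⟨
        Λ * (p / w * w)  ≈⟨ *-assoc Λ (p / w) w ⟨
        Λ * (p / w) * w  ∎)
    ; h≤Λw = ≤-trans (x≤z*y⇒x/y≤z (w>0 sh) (begin
        p        ≤⟨ x≤x+y (proj₁ 0<q) ⟩
        p + q    ≈⟨ wh≈A sh ⟨
        w * h    ≈⟨ *-comm w h ⟩
        h * w    ∎)) (h≤Λw sh)
    }

  slices-fill : ∀ {Λ w h p q} → Shape Λ (p + q) w h → p / w + q / w ≈ h
  slices-fill {Λ} {w} {h} {p} {q} sh = begin-equality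
    p / w + q / w  ≈⟨ distribʳ (w ⁻¹) p q ⟨
    (p + q) / w    ≈⟨ *-congʳ (wh≈A sh) ⟨
    w * h / w      ≈⟨ *-congʳ (*-comm w h) ⟩
    h * w / w      ≈⟨ x*y*y⁻¹≈x (w>0 sh) ⟩
    h              ∎

  -- The extent of a rectangle along one axis, inside `[0, B]`. Treating the axes separately lets a
  -- cut change one span and reuse the other as it is.
  record Span (B len lo hi : Carrier) : Set (ℓ₁ ⊔ ℓ₂) where
    field
      lo+len≈hi : lo + len ≈ hi
      0≤lo      : 0# ≤ lo
      hi≤B      : hi ≤ B

  open Span

  Span-≤ : ∀ {B len lo hi} → Span B len lo hi → 0# ≤ len → lo ≤ hi
  Span-≤ sp 0≤len = ≤-respʳ-≈ (lo+len≈hi sp) (x≤x+y 0≤len)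

  -- The dividing point is written `lo + a` because that is the term by which `cut` defines the
  -- shared edge.
  cut-span : ∀ {B len lo hi a b} → Span B len lo hi → a + b ≈ len → 0# ≤ a → 0# ≤ b →
             Span B a lo (lo + a) × Span B b (lo + a) hi
  cut-span {B} {len} {lo} {hi} {a} {b} sp a+b≈len 0≤a 0≤b =
    record { lo+len≈hi = ≈-refl ; 0≤lo = 0≤lo sp
           ; hi≤B = ≤-trans (Span-≤ upper 0≤b) (hi≤B sp) } ,
    upper
    where
    upper : Span B b (lo + a) hi
    upper = record
      { lo+len≈hi = ≈-trans (+-assoc lo a b) (≈-trans (+-congˡ a+b≈len) (lo+len≈hi sp))
      ; 0≤lo      = ≤-trans (0≤lo sp) (x≤x+y 0≤a)
      ; hi≤B      = hi≤B sp
      }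

  record _⊆_ (r r′ : Rect) : Set ℓ₂ where
    field
      x₁≤ : x₁ r′ ≤ x₁ r
      ≤x₂ : x₂ r ≤ x₂ r′
      y₁≤ : y₁ r′ ≤ y₁ r
      ≤y₂ : y₂ r ≤ y₂ r′

  open _⊆_

  Separated : Rect → Rect → Set ℓ₂
  Separated r r′ = (x₂ r ≤ x₁ r′ ⊎ x₂ r′ ≤ x₁ r) ⊎ (y₂ r ≤ y₁ r′ ⊎ y₂ r′ ≤ y₁ r)

  Separated-sym : Symmetric Separated
  Separated-sym = Sum.map Sum.swap Sum.swap

  -- This is why later cuts cannot create overlaps: parts of separated rectangles stay separated.
  Separated-⊆ : ∀ {r₀ r r′} → r₀ ⊆ r → Separated r r′ → Separated r₀ r′
  Separated-⊆ r₀⊆r = Sum.map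
    (Sum.map (≤-trans (≤x₂ r₀⊆r)) (λ le → ≤-trans le (x₁≤ r₀⊆r)))
    (Sum.map (≤-trans (≤y₂ r₀⊆r)) (λ le → ≤-trans le (y₁≤ r₀⊆r)))

  Separated⇒0≤max : ∀ {r r′} → Separated r r′ →
    0# ≤ max (max (x₁ r - x₂ r′) (y₁ r - y₂ r′)) (max (x₁ r′ - x₂ r) (y₁ r′ - y₂ r))
  Separated⇒0≤max (inj₁ (inj₁ le)) =
    ≤-trans (x≤y⇒0≤y-x le) (≤-trans (x≤x⊔y _ _) (x≤y⊔x _ _))
  Separated⇒0≤max (inj₁ (inj₂ le)) =
    ≤-trans (x≤y⇒0≤y-x le) (≤-trans (x≤x⊔y _ _) (x≤x⊔y _ _))
  Separated⇒0≤max (inj₂ (inj₁ le)) =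
    ≤-trans (x≤y⇒0≤y-x le) (≤-trans (x≤y⊔x _ _) (x≤y⊔x _ _))
  Separated⇒0≤max (inj₂ (inj₂ le)) =
    ≤-trans (x≤y⇒0≤y-x le) (≤-trans (x≤y⊔x _ _) (x≤x⊔y _ _))

  record Fits (W H Λ A : Carrier) (r : Rect) : Set (c ⊔ ℓ₁ ⊔ ℓ₂) where
    field
      shape : Shape Λ A (w r) (h r)
      xSpan : Span W (w r) (x₁ r) (x₂ r)
      ySpan : Span H (h r) (y₁ r) (y₂ r)

  Fits-resp-≈ : ∀ {W H Λ A A′ r} → A ≈ A′ → Fits W H Λ A r → Fits W H Λ A′ r
  Fits-resp-≈ A≈A′ fits = record
    { shape = record
      { w>0  = w>0 shape
      ; h>0  = h>0 shape
      ; wh≈A = ≈-trans (wh≈A shape) A≈A′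
      ; w≤Λh = w≤Λh shape
      ; h≤Λw = h≤Λw shape
      }
    ; xSpan = xSpan
    ; ySpan = ySpan
    }
    where open Fits fits

  record Dissection (W H Λ p q : Carrier) (r rᵃ rᵇ : Rect) : Set (c ⊔ ℓ₁ ⊔ ℓ₂) where
    field
      fitsᵃ : Fits W H Λ p rᵃ
      fitsᵇ : Fits W H Λ q rᵇ
      ᵃ⊆    : rᵃ ⊆ r
      ᵇ⊆    : rᵇ ⊆ r
      apart : Separated rᵃ rᵇ

  module _ {n} (s : Vector Carrier n) (W H : Carrier)
           (tie : Composite n → Composite n → Bool) where
    open IMP s W H tie

    cut-dissection : ∀ {Λ p q r} → Fits W H Λ (p + q) r → 0# < p → 0# < q →
      p + q ≤ Λ * p → p + q ≤ Λ * q →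
      Dissection W H Λ p q r (proj₁ (cut r p q)) (proj₂ (cut r p q))
    cut-dissection {Λ} {p} {q} {r} fits 0<p 0<q p+q≤Λp p+q≤Λq with 1# ≤? aspect r
    ... | yes 1≤γ = record
      { fitsᵃ = record { shape = top ; xSpan = xSpan ; ySpan = proj₂ spans }
      ; fitsᵇ = record { shape = bottom ; xSpan = xSpan ; ySpan = proj₁ spans }
      ; ᵃ⊆    = record { x₁≤ = ≤-refl ; ≤x₂ = ≤-refl
                       ; y₁≤ = Span-≤ (proj₁ spans) (proj₁ (h>0 bottom)) ; ≤y₂ = ≤-refl }
      ; ᵇ⊆    = record { x₁≤ = ≤-refl ; ≤x₂ = ≤-refl
                       ; y₁≤ = ≤-refl ; ≤y₂ = Span-≤ (proj₂ spans) (proj₁ (h>0 top)) }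
      ; apart = inj₂ (inj₂ ≤-refl)
      }
      where
      open Fits fits
      w≤h : w r ≤ h r
      w≤h = ≤-respˡ-≈ (*-identityˡ (w r)) (z≤x/y⇒z*y≤x (w>0 shape) 1≤γ)
      -- `slice` treats the first summand of the area, so the part of area `q` needs the sum in the
      -- other order.
      fits′ : Fits W H Λ (q + p) r
      fits′ = Fits-resp-≈ (+-comm p q) fits
      top : Shape Λ p (w r) (p / w r)
      top = slice shape w≤h 0<p 0<q p+q≤Λp
      bottom : Shape Λ q (w r) (q / w r)
      bottom = slice (Fits.shape fits′) w≤h 0<q 0<p (≤-respˡ-≈ (+-comm p q) p+q≤Λq)
      -- Heights are measured from below, so the smaller part `q` comes first here, whereas in the
      -- other branch the larger part `p` on the left comes first.
      spans = cut-span ySpan (slices-fill (Fits.shape fits′))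
                (proj₁ (h>0 bottom)) (proj₁ (h>0 top))
    ... | no 1≰γ = record
      { fitsᵃ = record { shape = left ; xSpan = proj₁ spans ; ySpan = ySpan }
      ; fitsᵇ = record { shape = right ; xSpan = proj₂ spans ; ySpan = ySpan }
      ; ᵃ⊆    = record { x₁≤ = ≤-refl ; ≤x₂ = Span-≤ (proj₂ spans) (proj₁ (w>0 right))
                       ; y₁≤ = ≤-refl ; ≤y₂ = ≤-refl }
      ; ᵇ⊆    = record { x₁≤ = Span-≤ (proj₁ spans) (proj₁ (w>0 left)) ; ≤x₂ = ≤-refl
                       ; y₁≤ = ≤-refl ; ≤y₂ = ≤-refl }
      ; apart = inj₁ (inj₁ ≤-refl)
      }
      where
      open Fits fits
      h≤w : h r ≤ w r
      h≤w = ≤-respʳ-≈ (*-identityˡ (w r)) (x/y≤z⇒x≤z*y (w>0 shape) (≰⇒≥ 1≰γ))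
      fits′ : Fits W H Λ (q + p) r
      fits′ = Fits-resp-≈ (+-comm p q) fits
      left : Shape Λ p (p / h r) (h r)
      -- The wide case is the tall case with the axes exchanged.
      left = transpose (slice (transpose shape) h≤w 0<p 0<q p+q≤Λp)
      right : Shape Λ q (q / h r) (h r)
      right = transpose (slice (transpose (Fits.shape fits′)) h≤w 0<q 0<p
                (≤-respˡ-≈ (+-comm p q) p+q≤Λq))
      spans = cut-span xSpan (slices-fill (transpose shape))
                (proj₁ (w>0 left)) (proj₁ (w>0 right))

-- Merge trees as sets of original modules, and the modules not yet merged.

data Leaf {n} (i : Fin n) : Composite n → Set where
  leaf   : Leaf i (single i)
  left   : ∀ {a b} → Leaf i a → Leaf i (merge a b)
  right  : ∀ {a b} → Leaf i b → Leaf i (merge a b)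

someLeaf : ∀ {n} (m : Composite n) → ∃ λ i → Leaf i m
someLeaf (single i)  = i , leaf
someLeaf (merge a _) = let i , i∈a = someLeaf a in i , left i∈a

Disjoint : ∀ {n} → Rel (Composite n) _
Disjoint a b = ∀ i → Leaf i a → ¬ Leaf i b

Disjoint-sym : ∀ {n} → Symmetric (Disjoint {n})
Disjoint-sym a∥b i i∈b i∈a = a∥b i i∈a i∈b

-- Every merge tree has a leaf, so no tree is disjoint from itself. The inequality is what keeps an
-- update of the partial placement at one module from overwriting another.
Disjoint⇒≢ : ∀ {n} {a b : Composite n} → Disjoint a b → a ≢ b
Disjoint⇒≢ {a = a} a∥a ≡.refl = let i , i∈a = someLeaf a in a∥a i i∈a i∈a

Disjoint-merge : ∀ {n} {a b m : Composite n} →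
                 Disjoint a m → Disjoint b m → Disjoint (merge a b) m
Disjoint-merge a∥m b∥m i (left i∈a)  = a∥m i i∈a
Disjoint-merge a∥m b∥m i (right i∈b) = b∥m i i∈b

Disjoint-single : ∀ {n} {i j : Fin n} → i ≢ j → Disjoint (single i) (single j)
Disjoint-single i≢j _ leaf leaf = i≢j ≡.refl

data IsMerge {n} : Composite n → Set where
  merge : ∀ {a b} → IsMerge (merge a b)

-- The original modules in the sequence are exactly those at the positions
-- below k, stored back to front.
data Remaining {n} : ℕ → List (Composite n) → Set where
  []       : Remaining 0 []
  merged   : ∀ {k a b xs} → Remaining k xs → Remaining k (merge a b ∷ xs)
  unmerged : ∀ i {xs} → Remaining (toℕ i) xs → Remaining (suc (toℕ i)) (single i ∷ xs)

Remaining-tail : ∀ {n k} {m : Composite n} {xs} →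
                 Remaining k (m ∷ xs) → ∃ λ k′ → Remaining k′ xs
Remaining-tail (merged rem)   = _ , rem
Remaining-tail (unmerged _ rem) = _ , rem

-- The condition says that `f` sends `i` to `k - 1 - i`. In additive form it passes to `f ∘ suc` by
-- cancelling one successor.
Remaining-tabulate : ∀ {n} k (f : Fin k → Fin n) →
                     (∀ i → toℕ (f i) ℕ.+ suc (toℕ i) ≡ k) →
                     Remaining k (toList (tabulate (single ∘ f)))
Remaining-tabulate zero    f f-rev = []
Remaining-tabulate (suc k) f f-rev =
  ≡.subst (λ l → Remaining (suc l) (toList (tabulate (single ∘ f)))) f0≡k
    (unmerged (f zero) (≡.subst (λ l → Remaining l rest) (≡.sym f0≡k)
      (Remaining-tabulate k (f ∘ suc) λ i →
        ℕ.suc-injective (≡.trans (≡.sym (ℕ.+-suc _ _)) (f-rev (suc i))))))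
  where
  rest : List (Composite _)
  rest = toList (tabulate (single ∘ f ∘ suc))
  f0≡k : toℕ (f zero) ≡ k
  f0≡k = ℕ.suc-injective (≡.trans (ℕ.+-comm 1 _) (f-rev zero))

module Correctness {c ℓ₁ ℓ₂} (F : OrderedField c ℓ₁ ℓ₂) {n : ℕ}
                   (s : Vector (OrderedField.Carrier F) n) (W H Λ : OrderedField.Carrier F)
                   (tie : Composite n → Composite n → Bool) where
  open OrderedField F
  open OrderedFieldProperties F
  open Geometry F
  open Placement F
  open IMP s W H tie
  open Rect
  open ≤-Reasoning poset

  -- Stage I: the sequence of modules and its invariant.

  total-area : List (Composite n) → Carrier
  total-area = List.foldr _+_ 0# ∘ List.map (area s)

  total-area-↭ : ∀ {xs ys} → xs ↭ ys → total-area xs ≈ total-area ys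
  total-area-↭ xs↭ys = Permutation.foldr-commMonoid setoid +-isCommutativeMonoid
    (↭⇒↭ₛ′ isEquivalence (map⁺ (area s) xs↭ys))

  insert-↭ : ∀ {k} m (xs : Vec (Composite n) k) → toList (insert m xs) ↭ m ∷ toList xs
  insert-↭ m []       = ↭-refl
  insert-↭ m (x ∷ xs) with area s x ≤? area s m
  ... | yes _ = trans (prep x (insert-↭ m xs)) (swap x m ↭-refl)
  ... | no  _ = ↭-refl

  Sorted : List (Composite n) → Set _
  Sorted = AllPairs (_≤_ on area s)

  insert-sorted : ∀ {k} m (xs : Vec (Composite n) k) →
                  Sorted (toList xs) → Sorted (toList (insert m xs))
  insert-sorted m []       []             = [] ∷ []
  insert-sorted m (x ∷ xs) (x≤xs ∷ xs-sorted) with area s x ≤? area s m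
  ... | yes x≤m = All-resp-↭ (↭-sym (insert-↭ m xs)) (x≤m ∷ x≤xs) ∷ insert-sorted m xs xs-sorted
  ... | no  x≰m = (≰⇒≥ x≰m ∷ All.map (≤-trans (≰⇒≥ x≰m)) x≤xs) ∷ x≤xs ∷ xs-sorted

  insert-remaining : ∀ {k l} a b (xs : Vec (Composite n) k) → Remaining l (toList xs) →
                     Remaining l (toList (insert (merge a b) xs))
  insert-remaining a b []       []  = merged []
  insert-remaining a b (x ∷ xs) rem with area s x ≤? area s (merge a b) | rem
  ... | yes _ | merged rem′     = merged (insert-remaining a b xs rem′)
  ... | yes _ | unmerged i rem′ = unmerged i (insert-remaining a b xs rem′)
  ... | no  _ | _               = merged rem

  -- The index is a natural number, so that the `k` of `Remaining k xs`, which may equal the length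
  -- of the vector, can be used directly. Past the end there is nothing to sum.
  sumFrom : ∀ {k} → ℕ → Vector Carrier k → Carrier
  sumFrom         zero    t = sum t
  sumFrom {zero}  (suc _) t = 0#
  sumFrom {suc _} (suc l) t = sumFrom l (tail t)

  sumFrom-toℕ : ∀ {k} (t : Vector Carrier k) i → sumFrom (toℕ i) t ≡ t i + sumAfter t i
  sumFrom-toℕ t zero    = ≡.refl
  sumFrom-toℕ t (suc i) = sumFrom-toℕ (tail t) i

  sumFrom-suc : ∀ {k} (t : Vector Carrier k) i → sumFrom (suc (toℕ i)) t ≡ sumAfter t i
  sumFrom-suc t zero    = ≡.refl
  sumFrom-suc t (suc i) = sumFrom-suc (tail t) i

  sumFrom-all : ∀ {k} (t : Vector Carrier k) → sumFrom k t ≡ 0#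
  sumFrom-all {zero}  t = ≡.refl
  sumFrom-all {suc k} t = sumFrom-all (tail t)

  -- Without composites, `xs` consists of the original modules at positions below `k`, and the
  -- remaining positions supply the rest of the total. Each induction step moves one `s i` from the
  -- tail sum into the list.
  remaining-total : ∀ {k xs} → Remaining k xs →
                    Any IsMerge xs ⊎ total-area xs + sumFrom k s ≈ sum s
  remaining-total []             = inj₂ (+-identityˡ _)
  remaining-total (merged _)     = inj₁ (here merge)
  remaining-total (unmerged i {xs} rem) = Sum.map there
    (λ eq → begin-equality
      s i + total-area xs + sumFrom (suc (toℕ i)) s
        ≡⟨ ≡.cong (s i + total-area xs +_) (sumFrom-suc s i) ⟩
      s i + total-area xs + sumAfter s i
        ≈⟨ solve 3 (λ x y z → x :+ y :+ z := y :+ (x :+ z)) ≈-refl _ _ _ ⟩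
      total-area xs + (s i + sumAfter s i)
        ≡⟨ ≡.cong (total-area xs +_) (sumFrom-toℕ s i) ⟨
      total-area xs + sumFrom (toℕ i) s
        ≈⟨ eq ⟩
      sum s  ∎)
    (remaining-total rem)

  -- `disjoint` keeps the merge trees pairwise different. `remaining` and `conserved` together
  -- determine the area of the head when all other modules are original. `doubled` bounds each
  -- composite by twice any module of the sequence.
  record Invariant (xs : List (Composite n)) : Set (c ⊔ ℓ₁ ⊔ ℓ₂) where
    field
      sorted    : Sorted xs
      disjoint  : AllPairs Disjoint xs
      remaining : ∃ λ k → Remaining k xs
      conserved : total-area xs ≈ sum s
      doubled   : All (λ m → IsMerge m → All (λ m′ → area s m ≤ area s m′ + area s m′) xs) xs

  originals : List (Composite n)
  originals = toList (tabulate (λ i → single (opposite i)))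

  -- The list runs from the last module to the first, so of two entries the one in front has the
  -- larger index.
  originals-AllPairs : ∀ {r} {R : Rel (Composite n) r} →
    (∀ {i j} → j Fin.< i → R (single i) (single j)) → AllPairs R originals
  originals-AllPairs {R = R} Rij = ≡.subst (AllPairs R) (≡.sym (toList-tabulate _))
    (AllPairs.tabulate⁺-< λ {i} {j} i<j → Rij (≡.subst₂ ℕ._<_
      (≡.sym (Fin.opposite-prop j)) (≡.sym (Fin.opposite-prop i))
      (ℕ.∸-monoʳ-< (ℕ.s<s i<j) (Fin.toℕ<n j))))

  single∈originals : ∀ i → single i ∈ originals
  single∈originals i = ≡.subst₂ _∈_ (≡.cong single (Fin.opposite-involutive i))
    (≡.sym (toList-tabulate _)) (∈-tabulate⁺ (opposite i))

  originals-remaining : Remaining n originals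
  originals-remaining = Remaining-tabulate n opposite λ i →
    ≡.trans (≡.cong (ℕ._+ suc (toℕ i)) (Fin.opposite-prop i)) (ℕ.m∸n+n≡m (Fin.toℕ<n i))

  singles-¬IsMerge : ∀ {k} (f : Fin k → Fin n) →
    All (λ m → ¬ IsMerge m) (toList (tabulate (single ∘ f)))
  singles-¬IsMerge {zero}  f = []
  singles-¬IsMerge {suc k} f = (λ ()) ∷ singles-¬IsMerge (f ∘ suc)

  originals-invariant : (∀ i j → i Fin.≤ j → s j ≤ s i) → Invariant originals
  originals-invariant s-mono = record
    { sorted    = originals-AllPairs λ {i} {j} j<i → s-mono j i (ℕ.<⇒≤ j<i)
    ; disjoint  = originals-AllPairs λ j<i → Disjoint-single (≢-sym (Fin.<⇒≢ j<i))
    ; remaining = n , originals-remaining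
    ; conserved = [ no-any-merge , drop-0 ]′ (remaining-total originals-remaining)
    ; doubled   = All.map (λ ¬m m → contradiction m ¬m) no-merge
    }
    where
    no-merge : All (λ m → ¬ IsMerge m) originals
    no-merge = singles-¬IsMerge opposite
    no-any-merge : Any IsMerge originals → total-area originals ≈ sum s
    no-any-merge any = let ¬m , m = All.lookupAny no-merge any in contradiction m ¬m
    drop-0 : total-area originals + sumFrom n s ≈ sum s → total-area originals ≈ sum s
    drop-0 eq = ≈-trans (sym (+-identityʳ _))
      (≈-trans (+-congˡ (reflexive (≡.sym (sumFrom-all s)))) eq)

  -- Stage II: partial placements of a sequence.

  Apart : Partial n → Composite n → Composite n → Set _
  Apart ρ m m′ = ∀ r r′ → ρ m ≡ just r → ρ m′ ≡ just r′ → Separated r r′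

  Apart-sym : ∀ ρ → Symmetric (Apart ρ)
  Apart-sym ρ sep r r′ r≡ r′≡ = Separated-sym {r′} {r} (sep r′ r r′≡ r≡)

  -- Here `xs` is a sequence from stage I. Stage II undoes the merges in reverse order, so it
  -- carries a placement of the sequence after a merge to one of the sequence before it.
  record Placed (ρ : Partial n) (xs : List (Composite n)) : Set (c ⊔ ℓ₁ ⊔ ℓ₂) where
    field
      located : All (λ m → ∃ λ r → ρ m ≡ just r × Fits W H Λ (area s m) r) xs
      apart   : AllPairs (Apart ρ) xs

  Placed-resp-↭ : ∀ {ρ xs ys} → xs ↭ ys → Placed ρ xs → Placed ρ ys
  Placed-resp-↭ {ρ} xs↭ys placed = record
    { located = All-resp-↭ xs↭ys located
    ; apart   = AllPairs-resp-↭ (Apart-sym ρ) xs↭ys apart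
    }
    where open Placed placed

  located-fits : ∀ {ρ m ms r} → Placed ρ (m ∷ ms) → ρ m ≡ just r → Fits W H Λ (area s m) r
  located-fits placed ρm≡r with Placed.located placed
  ... | (_ , ρm≡r′ , fits) ∷ _ =
    ≡.subst (Fits W H Λ _) (just-injective (≡.trans (≡.sym ρm≡r′) ρm≡r)) fits

  ≔-updated : ∀ (ρ : Partial n) m r → (ρ [ m ≔ r ]) m ≡ just r
  ≔-updated ρ m r rewrite dec-true (m ≟ m) ≡.refl = ≡.refl

  ≔-unchanged : ∀ (ρ : Partial n) {m m′} r → m ≢ m′ → (ρ [ m ≔ r ]) m′ ≡ ρ m′
  ≔-unchanged ρ {m} {m′} r m≢m′ rewrite dec-false (m ≟ m′) m≢m′ = ≡.refl

  -- Reduces all outcomes of the comparisons and of `tie` to two orders, which `split-placed` treats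
  -- symmetrically.
  largerFirst-either : ∀ a b → largerFirst a b ≡ (a , b) ⊎ largerFirst a b ≡ (b , a)
  largerFirst-either a b with area s b ≤? area s a | area s a ≤? area s b | tie a b
  ... | no  _ | _     | _     = inj₂ ≡.refl
  ... | yes _ | no  _ | _     = inj₁ ≡.refl
  ... | yes _ | yes _ | true  = inj₁ ≡.refl
  ... | yes _ | yes _ | false = inj₂ ≡.refl

  -- The modules in `ms` differ from `a` and `b` and so keep their rectangles. The new rectangles
  -- lie inside that of `c` and inherit its separation from the others.
  replace-placed : ∀ {ρ c a b ms r rᵃ rᵇ} → Placed ρ (c ∷ ms) → ρ c ≡ just r →
    AllPairs _≢_ (a ∷ b ∷ ms) → Dissection W H Λ (area s a) (area s b) r rᵃ rᵇ →
    Placed ((ρ [ a ≔ rᵃ ]) [ b ≔ rᵇ ]) (a ∷ b ∷ ms)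
  replace-placed {ρ} {c} {a} {b} {ms} {r} {rᵃ} {rᵇ}
                 placed ρc≡r ((a≢b ∷ a∉ms) ∷ b∉ms ∷ _) dissection
    with Placed.located placed | Placed.apart placed
  ... | _ ∷ located | c-apart ∷ apart = record
    { located = (rᵃ , σa≡rᵃ , fitsᵃ) ∷ (rᵇ , σb≡rᵇ , fitsᵇ) ∷
        All.zipWith (λ { (σm≡ρm , r′ , ρm≡r′ , fits) → r′ , ≡.trans σm≡ρm ρm≡r′ , fits })
          (unchanged , located)
    ; apart   = ((λ _ _ r≡ r′≡ → ≡.subst₂ Separated (det σa≡rᵃ r≡) (det σb≡rᵇ r′≡) ab-apart)
                  ∷ children-apart σa≡rᵃ ᵃ⊆)
                ∷ children-apart σb≡rᵇ ᵇ⊆ ∷ still-apart unchanged apart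
    }
    where
    open Dissection dissection renaming (apart to ab-apart)
    σ : Partial n
    σ = (ρ [ a ≔ rᵃ ]) [ b ≔ rᵇ ]
    σa≡rᵃ : σ a ≡ just rᵃ
    σa≡rᵃ = ≡.trans (≔-unchanged (ρ [ a ≔ rᵃ ]) rᵇ (≢-sym a≢b)) (≔-updated ρ a rᵃ)
    σb≡rᵇ : σ b ≡ just rᵇ
    σb≡rᵇ = ≔-updated (ρ [ a ≔ rᵃ ]) b rᵇ
    det : ∀ {m r₁ r₂} → σ m ≡ just r₁ → σ m ≡ just r₂ → r₁ ≡ r₂
    det eq₁ eq₂ = just-injective (≡.trans (≡.sym eq₁) eq₂)
    unchanged : All (λ m → σ m ≡ ρ m) ms
    unchanged = All.zipWith
      (λ (a≢m , b≢m) → ≡.trans (≔-unchanged (ρ [ a ≔ rᵃ ]) rᵇ b≢m) (≔-unchanged ρ rᵃ a≢m))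
      (a∉ms , b∉ms)
    children-apart : ∀ {m rᵐ} → σ m ≡ just rᵐ → rᵐ ⊆ r →
      All (Apart σ m) ms
    children-apart σm≡ ⊆r = All.zipWith
      (λ (σm′≡ρm′ , sep) _ r₂ r₁≡ r₂≡ → ≡.subst (λ r₁ → Separated r₁ r₂) (det σm≡ r₁≡)
        (Separated-⊆ {r′ = r₂} ⊆r (sep r r₂ ρc≡r (≡.trans (≡.sym σm′≡ρm′) r₂≡))))
      (unchanged , c-apart)
    still-apart : ∀ {xs} → All (λ m → σ m ≡ ρ m) xs →
      AllPairs (Apart ρ) xs → AllPairs (Apart σ) xs
    still-apart []         []           = []
    still-apart (eq ∷ eqs) (sep ∷ seps) =
      All.zipWith (λ (eq′ , sep′) r r′ r≡ r′≡ →
        sep′ r r′ (≡.trans (≡.sym eq) r≡) (≡.trans (≡.sym eq′) r′≡)) (eqs , sep)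
      ∷ still-apart eqs seps

  -- The effect of one cut and of one merge when areas are positive.

  module _ (s>0 : ∀ i → 0# < s i) where

    area-pos : ∀ m → 0# < area s m
    area-pos (single i)  = s>0 i
    area-pos (merge a b) = +-pos (area-pos a) (area-pos b)

    split-placed : ∀ {ρ mᵢ mⱼ ms r} →
      Placed ρ (merge mᵢ mⱼ ∷ ms) → ρ (merge mᵢ mⱼ) ≡ just r →
      AllPairs _≢_ (mᵢ ∷ mⱼ ∷ ms) →
      area s mᵢ + area s mⱼ ≤ Λ * area s mᵢ → area s mᵢ + area s mⱼ ≤ Λ * area s mⱼ →
      Placed (split mᵢ mⱼ r ρ) (mᵢ ∷ mⱼ ∷ ms)
    split-placed {ρ} {mᵢ} {mⱼ} {ms} {r} placed ρc≡r distinct ≤Λᵢ ≤Λⱼ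
      with fits ← located-fits placed ρc≡r
      with largerFirst mᵢ mⱼ | largerFirst-either mᵢ mⱼ
    ... | _ | inj₁ ≡.refl = replace-placed placed ρc≡r distinct
          (cut-dissection s W H tie fits (area-pos mᵢ) (area-pos mⱼ) ≤Λᵢ ≤Λⱼ)
    -- The reversed order is the same argument with the two sub-modules exchanged, followed by a
    -- swap back.
    ... | _ | inj₂ ≡.refl = Placed-resp-↭ (swap mⱼ mᵢ ↭-refl) (replace-placed placed ρc≡r
          (AllPairs-resp-↭ ≢-sym (swap mᵢ mⱼ ↭-refl) distinct)
          (cut-dissection s W H tie (Fits-resp-≈ (+-comm _ _) fits) (area-pos mⱼ) (area-pos mᵢ)
            (≤-respˡ-≈ (+-comm _ _) ≤Λⱼ) (≤-respˡ-≈ (+-comm _ _) ≤Λᵢ)))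

    -- Everything is shown for the list with the new composite in front and then carried along the
    -- permutation that `insert` performs. Only the sorting depends on where it lands.
    merge-invariant : ∀ {k} mⱼ mᵢ (ms : Vec (Composite n) k) →
                      Invariant (toList (mⱼ ∷ mᵢ ∷ ms)) →
                      Invariant (toList (insert (merge mᵢ mⱼ) ms))
    merge-invariant mⱼ mᵢ ms inv
      with Invariant.sorted inv | Invariant.disjoint inv | Invariant.doubled inv
    ... | (_ ∷ mⱼ≤ms) ∷ mᵢ≤ms ∷ ms-sorted
        | (_ ∷ mⱼ∥ms) ∷ mᵢ∥ms ∷ ms-disjoint
        | _ ∷ _ ∷ ms-doubled = record
      { sorted    = insert-sorted mᶜ ms ms-sorted
      ; disjoint  = AllPairs-resp-↭ Disjoint-sym perm
          (All.zipWith (λ (i∥m , j∥m) → Disjoint-merge i∥m j∥m) (mᵢ∥ms , mⱼ∥ms) ∷ ms-disjoint)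
      ; remaining = let _ , rem  = Invariant.remaining inv
                        _ , rem′ = Remaining-tail rem
                        k , rem″ = Remaining-tail rem′
                    in k , insert-remaining mᵢ mⱼ ms rem″
      ; conserved = begin-equality
          total-area (toList (insert mᶜ ms))                     ≈⟨ total-area-↭ perm ⟨
          area s mᵢ + area s mⱼ + total-area (toList ms)
            ≈⟨ solve 3 (λ x y z → x :+ y :+ z := y :+ (x :+ z)) ≈-refl _ _ _ ⟩
          area s mⱼ + (area s mᵢ + total-area (toList ms))       ≈⟨ Invariant.conserved inv ⟩
          sum s                                                  ∎
      ; doubled   = All-resp-↭ perm
          (All.map (All-resp-↭ perm ∘_) (c-doubled ∷ All.map extend ms-doubled))
      }
      where
      mᶜ : Composite n
      mᶜ = merge mᵢ mⱼ
      perm : mᶜ ∷ toList ms ↭ toList (insert mᶜ ms)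
      perm = ↭-sym (insert-↭ mᶜ ms)
      Doubles : Composite n → Composite n → Set _
      Doubles m m′ = area s m ≤ area s m′ + area s m′
      -- Both parts are at most any module of `ms`, since they were the two least.
      c-doubled : IsMerge mᶜ → All (Doubles mᶜ) (mᶜ ∷ toList ms)
      c-doubled _ = x≤x+y (proj₁ (area-pos mᶜ)) ∷
        All.zipWith (λ (i≤m , j≤m) → +-mono-≤ i≤m j≤m) (mᵢ≤ms , mⱼ≤ms)
      mⱼ≤mᶜ : area s mⱼ ≤ area s mᶜ
      mⱼ≤mᶜ = x≤y+x (proj₁ (area-pos mᵢ))
      -- An older composite was at most twice `mⱼ`, and `mⱼ` is at most the new composite.
      extend : ∀ {m} → (IsMerge m → All (Doubles m) (mⱼ ∷ mᵢ ∷ toList ms)) →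
               IsMerge m → All (Doubles m) (mᶜ ∷ toList ms)
      extend m-doubled is-merge with m-doubled is-merge
      ... | m≤2mⱼ ∷ _ ∷ m≤2ms = ≤-trans m≤2mⱼ (+-mono-≤ mⱼ≤mᶜ mⱼ≤mᶜ) ∷ m≤2ms

    -- Balance of every merge, and the two stages combined.

    module _ (3≤Λ : 3# ≤ Λ)
             (dominated : ∀ p → 0# < sumAfter s p → s p ≤ (Λ - 1#) * sumAfter s p) where

      x+x+x≤Λx : ∀ {x} → 0# ≤ x → x + x + x ≤ Λ * x
      x+x+x≤Λx {x} 0≤x = begin
        x + x + x
          ≈⟨ +-cong (+-cong (*-identityˡ x) (*-identityˡ x)) (*-identityˡ x) ⟨
        1# * x + 1# * x + 1# * x         ≈⟨ +-congʳ (distribʳ x 1# 1#) ⟨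
        (1# + 1#) * x + 1# * x           ≈⟨ distribʳ x (1# + 1#) 1# ⟨
        3# * x                           ≤⟨ *-monoˡ-≤ 0≤x 3≤Λ ⟩
        Λ * x                            ∎

      balancedⱼ : ∀ {mⱼ mᵢ ms} → Invariant (mⱼ ∷ mᵢ ∷ ms) →
                  area s mᵢ + area s mⱼ ≤ Λ * area s mⱼ
      balancedⱼ {mⱼ} {mᵢ} {ms} inv with Invariant.doubled inv | Invariant.sorted inv
      ... | _ ∷ mᵢ-doubled ∷ ms-doubled | _ ∷ mᵢ≤ms ∷ _ = go mᵢ
        (proj₂ (Remaining-tail (proj₂ (Invariant.remaining inv))))
        (λ is-merge → All.head (mᵢ-doubled is-merge)) mᵢ≤ms
        (Invariant.conserved inv)
        where
        A : Carrier
        A = area s mⱼ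
        double : ∀ {x} → x ≤ A + A → x + A ≤ Λ * A
        double x≤A+A = ≤-trans (+-monoˡ-≤ A x≤A+A) (x+x+x≤Λx (proj₁ (area-pos mⱼ)))
        go : ∀ {k} m → Remaining k (m ∷ ms) → (IsMerge m → area s m ≤ A + A) →
          All (λ m′ → area s m ≤ area s m′) ms →
          A + (area s m + total-area ms) ≈ sum s → area s m + A ≤ Λ * A
        go (merge _ _) _ m≤2A _ _ = double (m≤2A merge)
        go (single p) (unmerged .p rem) _ p≤ms conserved with remaining-total rem
        -- Some module `m` of `ms` is a composite, and then `s p` is at most `m`, which is at most
        -- `A + A`.
        ... | inj₁ any = double (All.lookupWith
          (λ (p≤m , m-doubled) is-merge → ≤-trans p≤m (All.head (m-doubled is-merge)))
          (All.zip (p≤ms , ms-doubled)) any)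
        -- All of `ms` is original, so the ratio hypothesis applies at `p`. Adding `A` turns the
        -- factor `Λ - 1#` into `Λ`.
        ... | inj₂ eq = begin
          s p + A
            ≤⟨ +-monoˡ-≤ A (dominated p (<-respʳ-≈ A≈after (area-pos mⱼ))) ⟩
          (Λ - 1#) * sumAfter s p + A
            ≈⟨ +-cong (*-congˡ (sym A≈after)) (sym (*-identityˡ A)) ⟩
          (Λ - 1#) * A + 1# * A
            ≈⟨ distribʳ A (Λ - 1#) 1# ⟨
          (Λ - 1# + 1#) * A
            ≈⟨ *-congʳ (x-y+y≈x Λ 1#) ⟩
          Λ * A  ∎
          where
          -- The sequence and the original modules have the same total, and the part up to position
          -- `p` is common to both, so it cancels.
          A≈after : A ≈ sumAfter s p
          A≈after = +-cancelʳ (s p + total-area ms) A (sumAfter s p) (begin-equality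
            A + (s p + total-area ms)              ≈⟨ conserved ⟩
            sum s                                  ≈⟨ eq ⟨
            total-area ms + sumFrom (toℕ p) s      ≡⟨ ≡.cong (total-area ms +_) (sumFrom-toℕ s p) ⟩
            total-area ms + (s p + sumAfter s p)
              ≈⟨ solve 3 (λ x y z → x :+ (y :+ z) := z :+ (y :+ x)) ≈-refl _ _ _ ⟩
            sumAfter s p + (s p + total-area ms)   ∎)

      -- The last argument is a continuation: from any placement of the current sequence, stage II
      -- on the current stack ends with a placement of the original modules. Each merge pushes one
      -- entry and prepends the corresponding cut to it.
      stageI-placed : Fits W H Λ (sum s) circuit →
        ∀ {k} (xs : Vec (Composite n) (suc k)) st → Invariant (toList xs) →
        (∀ ρ → Placed ρ (toList xs) → Placed (stageII st ρ) originals) →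
        Placed (place (stageI xs st)) originals
      -- The single remaining module carries the whole area, so it fits the circuit.
      stageI-placed circuit-fits (m ∷ []) st inv complete = complete _ record
        { located = (circuit , ≔-updated (λ _ → nothing) m circuit ,
            Fits-resp-≈ (≈-trans (sym (Invariant.conserved inv)) (+-identityʳ _)) circuit-fits) ∷ []
        ; apart   = [] ∷ []
        }
      stageI-placed circuit-fits (mⱼ ∷ mᵢ ∷ ms) st inv complete =
        stageI-placed circuit-fits (insert (merge mᵢ mⱼ) ms) ((mᵢ , mⱼ) ∷ st)
          (merge-invariant mⱼ mᵢ ms inv) complete′
        where
        mⱼ≤mᵢ : area s mⱼ ≤ area s mᵢ
        mⱼ≤mᵢ with (mⱼ≤mᵢ ∷ _) ∷ _ ← Invariant.sorted inv = mⱼ≤mᵢ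
        balancedᵢ : area s mᵢ + area s mⱼ ≤ Λ * area s mᵢ
        -- The larger part is at least half of the total, hence more than enough as `Λ` is at least
        -- 3.
        balancedᵢ = ≤-trans (≤-trans (+-monoʳ-≤ _ mⱼ≤mᵢ) (x≤x+y (proj₁ (area-pos mᵢ))))
          (x+x+x≤Λx (proj₁ (area-pos mᵢ)))
        distinct : AllPairs _≢_ (mᵢ ∷ mⱼ ∷ toList ms)
        distinct = AllPairs-resp-↭ ≢-sym (swap mⱼ mᵢ ↭-refl)
          (AllPairs.map Disjoint⇒≢ (Invariant.disjoint inv))
        complete′ : ∀ ρ → Placed ρ (toList (insert (merge mᵢ mⱼ) ms)) →
                    Placed (stageII ((mᵢ , mⱼ) ∷ st) ρ) originals
        complete′ ρ placed with placed′ ← Placed-resp-↭ (insert-↭ (merge mᵢ mⱼ) ms) placed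
          with (r , ρc≡r , _) ∷ _ ← Placed.located placed′
          -- The composite is located, so the lookup in `stageII` succeeds and its `just` branch is
          -- taken.
          with ρ (merge mᵢ mⱼ) in eq | ρc≡r
        ... | just _ | ≡.refl = complete _ (Placed-resp-↭ (swap mᵢ mⱼ ↭-refl)
          (split-placed placed′ eq distinct balancedᵢ (balancedⱼ inv)))

  -- From a placement of the original modules to a feasible layout.

  Placed-originals⇒feasible : ∀ {ρ} → 0# < Λ → Placed ρ originals →
    ∃ λ (L : Fin n → Rect) → (∀ i → ρ (single i) ≡ just (L i)) × Feasible s (λ _ → Λ) W H L
  Placed-originals⇒feasible {ρ} 0<Λ placed = L , ρ≡L , record
    { w>0        = w>0 ∘ shape
    ; h>0        = h>0 ∘ shape
    ; wh≈s       = wh≈A ∘ shape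
    ; x₂-x₁≈w    = x+y≈z⇒z-x≈y ∘ lo+len≈hi ∘ xSpan
    ; y₂-y₁≈h    = x+y≈z⇒z-x≈y ∘ lo+len≈hi ∘ ySpan
    ; aspect-min = λ i → z*y≤x⇒z≤x/y (w>0 (shape i)) (w≤Λh⇒w/Λ≤h 0<Λ (w≤Λh (shape i)))
    ; aspect-max = λ i → x≤z*y⇒x/y≤z (w>0 (shape i)) (h≤Λw (shape i))
    ; no-overlap = λ {i} {j} i≢j → Separated⇒0≤max {L i} {L j} (separated i≢j)
    ; 0≤x₁       = 0≤lo ∘ xSpan
    ; x₁≤W       = λ i → ≤-trans (Span-≤ (xSpan i) (proj₁ (w>0 (shape i)))) (hi≤B (xSpan i))
    ; 0≤x₂       = λ i → ≤-trans (0≤lo (xSpan i)) (Span-≤ (xSpan i) (proj₁ (w>0 (shape i))))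
    ; x₂≤W       = hi≤B ∘ xSpan
    ; 0≤y₁       = 0≤lo ∘ ySpan
    ; y₁≤H       = λ i → ≤-trans (Span-≤ (ySpan i) (proj₁ (h>0 (shape i)))) (hi≤B (ySpan i))
    ; 0≤y₂       = λ i → ≤-trans (0≤lo (ySpan i)) (Span-≤ (ySpan i) (proj₁ (h>0 (shape i))))
    ; y₂≤H       = hi≤B ∘ ySpan
    }
    where
    open Shape
    open Span
    position : ∀ i → ∃ λ r → ρ (single i) ≡ just r × Fits W H Λ (s i) r
    position i = All.lookup (Placed.located placed) (single∈originals i)
    L : Fin n → Rect
    L = proj₁ ∘ position
    ρ≡L : ∀ i → ρ (single i) ≡ just (L i)
    ρ≡L = proj₁ ∘ proj₂ ∘ position
    fits : ∀ i → Fits W H Λ (s i) (L i)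
    fits = proj₂ ∘ proj₂ ∘ position
    shape : ∀ i → Shape Λ (s i) (w (L i)) (h (L i))
    shape = Fits.shape ∘ fits
    xSpan : ∀ i → Span W (w (L i)) (x₁ (L i)) (x₂ (L i))
    xSpan = Fits.xSpan ∘ fits
    ySpan : ∀ i → Span H (h (L i)) (y₁ (L i)) (y₂ (L i))
    ySpan = Fits.ySpan ∘ fits
    separated : ∀ {i j} → i ≢ j → Separated (L i) (L j)
    separated {i} {j} i≢j
      -- The pair may occur in the list in either order, and separation is symmetric.
      with ∈-AllPairs₂ (Placed.apart placed) (single∈originals i) (single∈originals j)
    ... | inj₁ ≡.refl     = contradiction ≡.refl i≢j
    ... | inj₂ (inj₁ sep) = sep _ _ (ρ≡L i) (ρ≡L j)
    ... | inj₂ (inj₂ sep) = Separated-sym {L j} {L i} (sep _ _ (ρ≡L j) (ρ≡L i))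

-- The ratio hypothesis in product form, and the conclusion.

module _ {c ℓ₁ ℓ₂} (F : OrderedField c ℓ₁ ℓ₂) where
  open OrderedField F
  open OrderedFieldProperties F
  open Placement F using (sumAfter)

  sumAfter-last : ∀ {n} (s : Vector Carrier (suc n)) → sumAfter s (fromℕ n) ≡ 0#
  sumAfter-last {zero}  s = ≡.refl
  sumAfter-last {suc n} s = sumAfter-last (tail s)

  -- The ratio is given at every position but the last. There the sum of later areas is 0, which the
  -- positivity premise excludes.
  ratio⇒dominated : ∀ {n μ} (s : Vector Carrier (suc n)) →
    (∀ (i : Fin n) → s (inject₁ i) / sumAfter s (inject₁ i) ≤ μ) →
    ∀ p → 0# < sumAfter s p → s p ≤ μ * sumAfter s p
  ratio⇒dominated s ratio p 0<after with view p
  ... | ‵inject₁ i = x/y≤z⇒x≤z*y 0<after (ratio i)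
  ... | ‵fromℕ     = contradiction (reflexive (≡.sym (sumAfter-last s))) (proj₂ 0<after)

theorem1 : ∀ {c ℓ₁ ℓ₂} (F : OrderedField c ℓ₁ ℓ₂) →
    let open OrderedField F
        open Placement F
    in
    (n : ℕ) (s : Vector Carrier (suc n)) (W H Λ : Carrier)
    (tie : Composite (suc n) → Composite (suc n) → Bool) →
    (∀ i j → i Fin.≤ j → s j ≤ s i) →
    (∀ i → 0# < s i) →
    0# < W →
    0# < H →
    W * H ≈ sum s →
    3# ≤ Λ →
    1# / Λ ≤ H / W →
    H / W ≤ Λ →
    (∀ (i : Fin n) → s (inject₁ i) / sumAfter s (inject₁ i) ≤ Λ - 1#) →
    IMPPlacesFeasibly s W H tie (λ _ → Λ)
theorem1 F n s W H Λ tie s-mono s>0 W>0 H>0 WH≈S 3≤Λ 1/Λ≤γ γ≤Λ ratio =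
  Placed-originals⇒feasible 0<Λ
    (stageI-placed s>0 3≤Λ (ratio⇒dominated F s ratio) circuit-fits
      -- With an empty stack, stage II returns its argument, so the initial continuation is the
      -- identity.
      (tabulate (λ i → single (opposite i))) [] (originals-invariant s-mono) (λ _ placed → placed))
  where
  open OrderedField F
  open OrderedFieldProperties F
  open Geometry F
  open Placement F
  open Correctness F s W H Λ tie
  open IMP s W H tie using (circuit)
  0<Λ : 0# < Λ
  0<Λ = <-≤-trans (<-≤-trans (0≤1 , 0≉1) (≤-trans (x≤x+y 0≤1) (x≤x+y 0≤1))) 3≤Λ
  circuit-fits : Fits W H Λ (sum s) circuit
  circuit-fits = record
    { shape = record
      { w>0  = W>0
      ; h>0  = H>0
      ; wh≈A = WH≈S
      ; w≤Λh = w/Λ≤h⇒w≤Λh 0<Λ (z≤x/y⇒z*y≤x W>0 1/Λ≤γ)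
      ; h≤Λw = x/y≤z⇒x≤z*y W>0 γ≤Λ
      }
    ; xSpan = record { lo+len≈hi = +-identityˡ W ; 0≤lo = ≤-refl ; hi≤B = ≤-refl }
    ; ySpan = record { lo+len≈hi = +-identityˡ H ; 0≤lo = ≤-refl ; hi≤B = ≤-refl }
    }
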